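{- Let $\Pi$ be a nested logic program, $\varphi$ a propositional formula, $V=\mathrm{var}(\Pi)$, and $W=\mathrm{var}(\Pi)\cup\mathrm{var}(\varphi)$. Then: 1. $\Pi$ has a stable model iff $\models\exists V'\,\mathcal{S}[\Pi]$; 2. $\varphi$ is true under some stable model of $\Pi$ (written $\Pi\mid\!\sim_b\varphi$) iff $\models\exists W'\big(\mathcal{S}[\Pi]\wedge\varphi'\big)$; 3. $\varphi$ is true under all stable models of $\Pi$ (written $\Pi\mid\!\sim_s\varphi$) iff $\models\forall W'\big(\mathcal{S}[\Pi]\supset\varphi'\big)$.
   Context: Formulas are built from atoms, $\top,\bot$, and $\neg,\wedge,\vee,\supset$; an expression is a formula without $\supset$; $\mathrm{var}(\cdot)$ is the set of variables occurring. A classical interpretation is a set $I$ of atoms ($p$ true iff $p\in I$). A finite set of formulas is identified with the conjunction of its elements (empty conjunction $=\top$). Programs: a rule $r$ is a pair $H(r)\leftarrow B(r)$ of expressions; a (nested logic) program is a finite set of rules; $\hat\Pi=\{B(r)\supset H(r)\mid r\in\Pi\}$. A program is basic if it contains no $\neg$; $I$ is a model of a basic program iff it is a classical model of $\hat\Pi$. The reduct $\Pi^I$ is obtained from $\Pi$ by replacing every occurrence of an expression $\neg\psi$ not in the scope of another negation by $\top$ if $\neg\psi$ is classically true under $I$, and by $\bot$ otherwise. $I$ is a stable model of $\Pi$ iff $I$ is a $\subseteq$-minimal model of $\Pi^I$. Priming: for each atom $p$, $p'$ is a globally new atom; $\varphi'$ replaces every atom $p$ of $\varphi$ by $p'$ (likewise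 for sets of formulas); for a set $I$ of atoms, $I'=\{p'\mid p\in I\}$. QBFs extend propositional formulas by quantifiers over atoms: under $I$, $\forall p\,\Psi$ is true iff both $\Psi[p/\top]$ and $\Psi[p/\bot]$ are true, $\exists p\,\Psi$ iff at least one is. $\models\Phi$ means $\Phi$ is true under every interpretation. $\exists P\,\Phi$, $\forall P\,\Phi$ for a finite set $P$ of atoms quantify all atoms of $P$. For indexed sets $S=\{\varphi_i\}$, $T=\{\psi_i\}$ of $n$ formulas, $S\le T$ abbreviates $\bigwedge_i(\varphi_i\supset\psi_i)$ and $S<T$ abbreviates $(S\le T)\wedge\neg(T\le S)$; in $V<V'$ the atom $p$ is paired with $p'$. Translation $\tau$ on expressions: $\tau[\varphi]=\varphi$ if $\varphi$ is an atom, $\top$ or $\bot$; $\tau[\varphi_1\circ\varphi_2]=\tau[\varphi_1]\circ\tau[\varphi_2]$ for $\circ\in\{\wedge,\vee\}$; $\tau[\neg\psi]=\neg\psi'$. The encoding is $\mathcal{S}[\Pi]=\hat\Pi'\wedge\neg\exists V\big((V<V')\wedge\bigwedge_{r\in\Pi}(\tau[B(r)]\supset\tau[H(r)])\big)$, where $V=\mathrm{var}(\Pi)$.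
   Formalization: In part 2 (from right to left) and part 3 (from left to right) it is additionally assumed that var(φ) ⊆ var(Π); without this the claim fails, e.g. for Π = ∅ with φ = q in part 2 and φ = ¬q in part 3. -}

module Defs where

open import Data.Bool as Bool using (Bool; true; false; not; if_then_else_)
open import Data.List using (List; []; _∷_; _++_; map; foldr; concatMap)
open import Data.Nat as ℕ using (ℕ; suc; s≤s)
open import Data.Nat.Induction using (<-wellFounded)
open import Data.Nat.Properties using (≤-refl; ≤-reflexive; m≤m+n; m≤n+m)
open import Data.Product using (_×_; _,_; ∃)
open import Data.Sum using (_⊎_; inj₁; inj₂)
open import Data.Sum.Properties using (≡-dec)
open import Data.Vec as Vec using (Vec; fromList; toList; zipWith)
open import Function using (_∘_)
open import Induction.WellFounded using (Acc; acc)
open import Relation.Binary.Definitions using (DecidableEquality)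
open import Relation.Binary.PropositionalEquality using (_≡_; refl; cong; cong₂)
open import Relation.Nullary using (yes; no)

private variable
  A : Set

infix  30 ¬_
infixr 25 _∧_
infixr 24 _∨_
infixr 23 _⊃_
infixr 22 ∀[_]_ ∃[_]_ ∀*[_]_ ∃*[_]_

data Expression (A : Set) : Set where
  atom    : A → Expression A
  ⊤ ⊥     : Expression A
  ¬_      : Expression A → Expression A
  _∧_ _∨_ : Expression A → Expression A → Expression A

data Formula (A : Set) : Set where
  atom        : A → Formula A
  ⊤ ⊥         : Formula A
  ¬_          : Formula A → Formula A
  _∧_ _∨_ _⊃_ : Formula A → Formula A → Formula A

data QBF (A : Set) : Set where
  atom        : A → QBF A
  ⊤ ⊥         : QBF A
  ¬_          : QBF A → QBF A
  _∧_ _∨_ _⊃_ : QBF A → QBF A → QBF A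
  ∀[_]_ ∃[_]_ : A → QBF A → QBF A

⌊_⌋ : Expression A → Formula A
⌊ atom p ⌋ = atom p
⌊ ⊤ ⌋      = ⊤
⌊ ⊥ ⌋      = ⊥
⌊ ¬ ψ ⌋    = ¬ ⌊ ψ ⌋
⌊ ψ ∧ χ ⌋  = ⌊ ψ ⌋ ∧ ⌊ χ ⌋
⌊ ψ ∨ χ ⌋  = ⌊ ψ ⌋ ∨ ⌊ χ ⌋

⌈_⌉ : Formula A → QBF A
⌈ atom p ⌉ = atom p
⌈ ⊤ ⌉      = ⊤
⌈ ⊥ ⌉      = ⊥
⌈ ¬ φ ⌉    = ¬ ⌈ φ ⌉
⌈ φ ∧ ψ ⌉  = ⌈ φ ⌉ ∧ ⌈ ψ ⌉
⌈ φ ∨ ψ ⌉  = ⌈ φ ⌉ ∨ ⌈ ψ ⌉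
⌈ φ ⊃ ψ ⌉  = ⌈ φ ⌉ ⊃ ⌈ ψ ⌉

-- Finite sets (of atoms, formulas, rules) are lists; nothing below depends on
-- the order or multiplicity of their elements.

var : Formula A → List A
var (atom p) = p ∷ []
var ⊤        = []
var ⊥        = []
var (¬ φ)    = var φ
var (φ ∧ ψ)  = var φ ++ var ψ
var (φ ∨ ψ)  = var φ ++ var ψ
var (φ ⊃ ψ)  = var φ ++ var ψ

⋀ : List (Formula A) → Formula A
⋀ = foldr _∧_ ⊤

-- A set of atoms, given by its characteristic function: classical truth is
-- two-valued, so membership has to be decidable.
Interpretation : Set → Set
Interpretation A = A → Bool

_⊑_ : Interpretation A → Interpretation A → Set
I ⊑ J = ∀ p → I p ≡ true → J p ≡ true

⟦_⟧ : Formula A → Interpretation A → Bool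
⟦ atom p ⟧ I = I p
⟦ ⊤ ⟧      I = true
⟦ ⊥ ⟧      I = false
⟦ ¬ φ ⟧    I = not (⟦ φ ⟧ I)
⟦ φ ∧ ψ ⟧  I = ⟦ φ ⟧ I Bool.∧ ⟦ ψ ⟧ I
⟦ φ ∨ ψ ⟧  I = ⟦ φ ⟧ I Bool.∨ ⟦ ψ ⟧ I
⟦ φ ⊃ ψ ⟧  I = not (⟦ φ ⟧ I) Bool.∨ ⟦ ψ ⟧ I

infix 20 _⊩_
_⊩_ : Interpretation A → Formula A → Set
I ⊩ φ = ⟦ φ ⟧ I ≡ true

record Rule (A : Set) : Set where
  constructor _←_
  field
    H B : Expression A

open Rule public

Program : Set → Set
Program A = List (Rule A)

hat : Program A → List (Formula A)
hat = map (λ r → ⌊ B r ⌋ ⊃ ⌊ H r ⌋)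

varᴾ : Program A → List A
varᴾ = concatMap var ∘ hat

-- ¬ ψ is replaced as a whole, so only outermost negations are treated.
reduct : Interpretation A → Expression A → Expression A
reduct I (atom p) = atom p
reduct I ⊤        = ⊤
reduct I ⊥        = ⊥
reduct I (¬ ψ)    = if ⟦ ⌊ ¬ ψ ⌋ ⟧ I then ⊤ else ⊥
reduct I (ψ ∧ χ)  = reduct I ψ ∧ reduct I χ
reduct I (ψ ∨ χ)  = reduct I ψ ∨ reduct I χ

_^_ : Program A → Interpretation A → Program A
Π ^ I = map (λ r → reduct I (H r) ← reduct I (B r)) Π

-- The notion of model for basic programs; applied below to reducts only.
Model : Program A → Interpretation A → Set
Model Π I = I ⊩ ⋀ (hat Π)

StableModel : Program A → Interpretation A → Set
StableModel Π I =
  Model (Π ^ I) I × (∀ J → Model (Π ^ I) J → J ⊑ I → I ⊑ J)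

infix 20 _∣∼b_ _∣∼s_

_∣∼b_ : Program A → Formula A → Set
Π ∣∼b φ = ∃ λ I → StableModel Π I × I ⊩ φ

_∣∼s_ : Program A → Formula A → Set
Π ∣∼s φ = ∀ I → StableModel Π I → I ⊩ φ

const : Bool → QBF A
const true  = ⊤
const false = ⊥

size : QBF A → ℕ
size (atom p)   = 0
size ⊤          = 0
size ⊥          = 0
size (¬ Φ)      = suc (size Φ)
size (Φ ∧ Ψ)    = suc (size Φ ℕ.+ size Ψ)
size (Φ ∨ Ψ)    = suc (size Φ ℕ.+ size Ψ)
size (Φ ⊃ Ψ)    = suc (size Φ ℕ.+ size Ψ)
size (∀[ p ] Φ) = suc (size Φ)
size (∃[ p ] Φ) = suc (size Φ)

size-const : ∀ b → size {A} (const b) ≡ 0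
size-const true  = refl
size-const false = refl

module Semantics {A : Set} (_≟_ : DecidableEquality A) where

  -- Substitution for the free occurrences of p.
  infix 31 _[_/_]
  _[_/_] : QBF A → A → Bool → QBF A
  atom q [ p / b ] with p ≟ q
  ... | yes _ = const b
  ... | no  _ = atom q
  ⊤       [ p / b ] = ⊤
  ⊥       [ p / b ] = ⊥
  (¬ Φ)   [ p / b ] = ¬ (Φ [ p / b ])
  (Φ ∧ Ψ) [ p / b ] = Φ [ p / b ] ∧ Ψ [ p / b ]
  (Φ ∨ Ψ) [ p / b ] = Φ [ p / b ] ∨ Ψ [ p / b ]
  (Φ ⊃ Ψ) [ p / b ] = Φ [ p / b ] ⊃ Ψ [ p / b ]
  (∀[ q ] Φ) [ p / b ] with p ≟ q
  ... | yes _ = ∀[ q ] Φ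
  ... | no  _ = ∀[ q ] (Φ [ p / b ])
  (∃[ q ] Φ) [ p / b ] with p ≟ q
  ... | yes _ = ∃[ q ] Φ
  ... | no  _ = ∃[ q ] (Φ [ p / b ])

  size-[/] : ∀ Φ p b → size (Φ [ p / b ]) ≡ size Φ
  size-[/] (atom q) p b with p ≟ q
  ... | yes _ = size-const {A} b
  ... | no  _ = refl
  size-[/] ⊤       p b = refl
  size-[/] ⊥       p b = refl
  size-[/] (¬ Φ)   p b = cong suc (size-[/] Φ p b)
  size-[/] (Φ ∧ Ψ) p b = cong suc (cong₂ ℕ._+_ (size-[/] Φ p b) (size-[/] Ψ p b))
  size-[/] (Φ ∨ Ψ) p b = cong suc (cong₂ ℕ._+_ (size-[/] Φ p b) (size-[/] Ψ p b))
  size-[/] (Φ ⊃ Ψ) p b = cong suc (cong₂ ℕ._+_ (size-[/] Φ p b) (size-[/] Ψ p b))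
  size-[/] (∀[ q ] Φ) p b with p ≟ q
  ... | yes _ = refl
  ... | no  _ = cong suc (size-[/] Φ p b)
  size-[/] (∃[ q ] Φ) p b with p ≟ q
  ... | yes _ = refl
  ... | no  _ = cong suc (size-[/] Φ p b)

  -- The quantifier clauses recurse on instances Φ [ p / b ], which are not
  -- subterms; hence the recursion on size.
  truth-acc : Interpretation A → (Φ : QBF A) → Acc ℕ._<_ (size Φ) → Bool
  truth-acc I (atom p) _ = I p
  truth-acc I ⊤        _ = true
  truth-acc I ⊥        _ = false
  truth-acc I (¬ Φ)    (acc rs) = not (truth-acc I Φ (rs ≤-refl))
  truth-acc I (Φ ∧ Ψ)  (acc rs) =
    truth-acc I Φ (rs (s≤s (m≤m+n (size Φ) (size Ψ)))) Bool.∧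
    truth-acc I Ψ (rs (s≤s (m≤n+m (size Ψ) (size Φ))))
  truth-acc I (Φ ∨ Ψ)  (acc rs) =
    truth-acc I Φ (rs (s≤s (m≤m+n (size Φ) (size Ψ)))) Bool.∨
    truth-acc I Ψ (rs (s≤s (m≤n+m (size Ψ) (size Φ))))
  truth-acc I (Φ ⊃ Ψ)  (acc rs) =
    not (truth-acc I Φ (rs (s≤s (m≤m+n (size Φ) (size Ψ))))) Bool.∨
    truth-acc I Ψ (rs (s≤s (m≤n+m (size Ψ) (size Φ))))
  truth-acc I (∀[ p ] Φ) (acc rs) =
    truth-acc I (Φ [ p / true  ]) (rs (s≤s (≤-reflexive (size-[/] Φ p true)))) Bool.∧
    truth-acc I (Φ [ p / false ]) (rs (s≤s (≤-reflexive (size-[/] Φ p false))))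
  truth-acc I (∃[ p ] Φ) (acc rs) =
    truth-acc I (Φ [ p / true  ]) (rs (s≤s (≤-reflexive (size-[/] Φ p true)))) Bool.∨
    truth-acc I (Φ [ p / false ]) (rs (s≤s (≤-reflexive (size-[/] Φ p false))))

  truth : Interpretation A → QBF A → Bool
  truth I Φ = truth-acc I Φ (<-wellFounded (size Φ))

infix 20 ⊨⟨_⟩_
⊨⟨_⟩_ : DecidableEquality A → QBF A → Set
⊨⟨ _≟_ ⟩ Φ = ∀ I → Semantics.truth _≟_ I Φ ≡ true

∀*[_]_ ∃*[_]_ : List A → QBF A → QBF A
∀*[ P ] Φ = foldr ∀[_]_ Φ P
∃*[ P ] Φ = foldr ∃[_]_ Φ P

_≤_ _<_ : ∀ {n} → Vec (Formula A) n → Vec (Formula A) n → Formula A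
S ≤ T = ⋀ (toList (zipWith _⊃_ S T))
S < T = (S ≤ T) ∧ ¬ (T ≤ S)

-- Programs and query formulas live over A, encodings over A ⁺, where the
-- primed atoms are globally new by construction.
infix 35 _⁺ _⁺-≟
_⁺ : Set → Set
A ⁺ = A ⊎ A

pattern plain  p = inj₁ p
pattern primed p = inj₂ p

_⁺-≟ : DecidableEquality A → DecidableEquality (A ⁺)
_≟_ ⁺-≟ = ≡-dec _≟_ _≟_

infix 35 _′
_′ : Formula A → Formula (A ⁺)
atom p  ′ = atom (primed p)
⊤       ′ = ⊤
⊥       ′ = ⊥
(¬ φ)   ′ = ¬ (φ ′)
(φ ∧ ψ) ′ = φ ′ ∧ ψ ′
(φ ∨ ψ) ′ = φ ′ ∨ ψ ′
(φ ⊃ ψ) ′ = φ ′ ⊃ ψ ′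

τ : Expression A → Formula (A ⁺)
τ (atom p) = atom (plain p)
τ ⊤        = ⊤
τ ⊥        = ⊥
τ (¬ ψ)    = ¬ (⌊ ψ ⌋ ′)
τ (ψ ∧ χ)  = τ ψ ∧ τ χ
τ (ψ ∨ χ)  = τ ψ ∨ τ χ

𝒮[_] : Program A → QBF (A ⁺)
𝒮[ Π ] =
  ⌈ ⋀ (map _′ (hat Π)) ⌉ ∧
  ¬ (∃*[ map plain (varᴾ Π) ]
      (⌈ V < V′ ⌉ ∧ ⌈ ⋀ (map (λ r → τ (B r) ⊃ τ (H r)) Π) ⌉))
  where
  V  = Vec.map (λ p → atom (plain p))  (fromList (varᴾ Π))
  V′ = Vec.map (λ p → atom (primed p)) (fromList (varᴾ Π))

module Submission where

-- Quantification over atoms is defined by substituting truth constants, but it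
-- amounts to varying the interpretation: `eval` takes this as the definition
-- of the quantifiers, and `truth-eval` shows that nothing changes.  Hence
-- ∃*[ P ] Φ is true under K iff Φ is true under some interpretation that agrees
-- with K outside P (`eval-∃*`), and dually for ∀*[ P ] Φ (`eval-∀*`).
--
-- An interpretation L of A ⁺ carries two interpretations of A: the candidate
-- I on the primed atoms, and a competitor J on the plain ones.  Since τ primes
-- exactly what lies below a negation, which is what the reduct evaluates under
-- I, τ ψ is true under L iff the reduct of ψ by I is true under J (`τ-reduct`).
-- So the existential formula negated in 𝒮[ Π ] says that Π ^ I has a model
-- strictly below I (`smaller-model`).  The other conjunct of 𝒮[ Π ] says that I is a model of
-- the program, equivalently of Π ^ I, because reducing by I does not change the
-- truth value under I (`reduct-self`).  Together, 𝒮[ Π ] expresses stability of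
-- I (`𝒮-stable`).
--
-- These arguments compare interpretations on V = varᴾ Π only, so it matters that atoms
-- outside V are false in I.  For stable models this follows from minimality
-- (`stable-support`); an arbitrary interpretation of the primed atoms is first
-- cut down to V (`𝒮-restrict`), which changes the truth value neither of 𝒮[ Π ]
-- nor of a formula with all its variables in V.

open import Defs
open import Data.Bool as Bool using (Bool; true; false; not; if_then_else_)
open import Data.Bool.Properties using (∧-conicalˡ; ∧-conicalʳ; not-¬)
open import Data.List using (List; []; _∷_; _++_; map)
open import Data.List.Membership.Propositional using (_∈_; _∉_)
open import Data.List.Membership.Propositional.Properties
  using (∈-++⁺ˡ; ∈-++⁺ʳ; ∈-map⁺; ∈-map⁻; ∈-concat⁺′)
import Data.List.Membership.DecPropositional as DecMembership
open import Data.List.Properties using (map-∘)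
open import Data.List.Relation.Binary.Subset.Propositional using (_⊆_)
open import Data.List.Relation.Unary.Any using (here; there)
open import Data.Nat as ℕ using ()
open import Data.Nat.Induction using (<-wellFounded)
open import Data.Product using (_×_; _,_; ∃; proj₁; proj₂)
open import Data.Sum using (_⊎_; inj₁; inj₂; [_,_])
open import Data.Vec as Vec using (fromList)
open import Function using (_∘_)
open import Function.Bundles using (_⇔_; mk⇔; Equivalence)
open import Induction.WellFounded using (Acc; acc)
open import Relation.Binary.Definitions using (DecidableEquality)
open import Relation.Binary.PropositionalEquality
  using (_≡_; _≢_; _≗_; refl; sym; trans; cong; cong₂)
open import Relation.Nullary as Nullary using (yes; no; contradiction)

open Equivalence using (to; from)

private variable
  A X : Set

-- Truth tables

∧-true : ∀ a {b} → (a Bool.∧ b ≡ true) ⇔ (a ≡ true × b ≡ true)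
∧-true a {b} = mk⇔ (λ e → ∧-conicalˡ a b e , ∧-conicalʳ a b e)
                     (λ { (refl , refl) → refl })

∨-true : ∀ a {b} → (a Bool.∨ b ≡ true) ⇔ (a ≡ true ⊎ b ≡ true)
∨-true true  = mk⇔ inj₁ (λ _ → refl)
∨-true false = mk⇔ inj₂ (λ { (inj₁ ()) ; (inj₂ e) → e })

⊃-true : ∀ a {b} → (not a Bool.∨ b ≡ true) ⇔ (a ≡ true → b ≡ true)
⊃-true true  = mk⇔ (λ e _ → e) (λ f → f refl)
⊃-true false = mk⇔ (λ _ ()) (λ _ → refl)

not-true : ∀ {a} → (not a ≡ true) ⇔ (Nullary.¬ (a ≡ true))
not-true {true}  = mk⇔ (λ ()) (λ f → contradiction refl f)
not-true {false} = mk⇔ (λ _ ()) (λ _ → refl)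

infix 4 _≗⟨_⟩_
-- Agreement of two interpretations on a list of atoms.
_≗⟨_⟩_ : Interpretation A → List A → Interpretation A → Set
I ≗⟨ P ⟩ J = ∀ {p} → p ∈ P → I p ≡ J p

-- Quantified Boolean formulas

module Quantifiers {A : Set} (_≟_ : DecidableEquality A) where
  open Semantics _≟_
  open DecMembership _≟_ using (_∈?_)

  -- K with the value of p set to b.
  _[_↦_] : Interpretation A → A → Bool → Interpretation A
  (K [ p ↦ b ]) q = if Nullary.does (p ≟ q) then b else K q

  ↦-cong : ∀ {K L} p b → K ≗ L → K [ p ↦ b ] ≗ L [ p ↦ b ]
  ↦-cong p b e q with p ≟ q
  ... | yes _ = refl
  ... | no  _ = e q

  ↦-shadow : ∀ K p a b → K [ p ↦ a ] [ p ↦ b ] ≗ K [ p ↦ b ]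
  ↦-shadow K p a b q with p ≟ q
  ... | yes _ = refl
  ... | no  _ = refl

  ↦-swap : ∀ K {p q} a b → p ≢ q → K [ q ↦ a ] [ p ↦ b ] ≗ K [ p ↦ b ] [ q ↦ a ]
  ↦-swap K {p} {q} a b p≢q r with p ≟ r | q ≟ r
  ... | yes refl | yes refl = contradiction refl p≢q
  ... | yes _    | no  _    = refl
  ... | no  _    | yes _    = refl
  ... | no  _    | no  _    = refl

  -- Truth of a QBF by structural recursion: quantifiers change the value of
  -- the bound atom in the interpretation instead of substituting for it.
  eval : QBF A → Interpretation A → Bool
  eval (atom p)   K = K p
  eval ⊤          K = true
  eval ⊥          K = false
  eval (¬ Φ)      K = not (eval Φ K)
  eval (Φ ∧ Ψ)    K = eval Φ K Bool.∧ eval Ψ K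
  eval (Φ ∨ Ψ)    K = eval Φ K Bool.∨ eval Ψ K
  eval (Φ ⊃ Ψ)    K = not (eval Φ K) Bool.∨ eval Ψ K
  eval (∀[ p ] Φ) K = eval Φ (K [ p ↦ true ]) Bool.∧ eval Φ (K [ p ↦ false ])
  eval (∃[ p ] Φ) K = eval Φ (K [ p ↦ true ]) Bool.∨ eval Φ (K [ p ↦ false ])

  eval-cong : ∀ Φ {K L} → K ≗ L → eval Φ K ≡ eval Φ L
  eval-cong (atom p)   e = e p
  eval-cong ⊤          e = refl
  eval-cong ⊥          e = refl
  eval-cong (¬ Φ)      e = cong not (eval-cong Φ e)
  eval-cong (Φ ∧ Ψ)    e = cong₂ Bool._∧_ (eval-cong Φ e) (eval-cong Ψ e)
  eval-cong (Φ ∨ Ψ)    e = cong₂ Bool._∨_ (eval-cong Φ e) (eval-cong Ψ e)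
  eval-cong (Φ ⊃ Ψ)    e =
    cong₂ Bool._∨_ (cong not (eval-cong Φ e)) (eval-cong Ψ e)
  eval-cong (∀[ p ] Φ) e =
    cong₂ Bool._∧_ (eval-cong Φ (↦-cong p true e)) (eval-cong Φ (↦-cong p false e))
  eval-cong (∃[ p ] Φ) e =
    cong₂ Bool._∨_ (eval-cong Φ (↦-cong p true e)) (eval-cong Φ (↦-cong p false e))

  eval-const : ∀ b K → eval (const b) K ≡ b
  eval-const true  K = refl
  eval-const false K = refl

  eval-[/] : ∀ Φ p b K → eval (Φ [ p / b ]) K ≡ eval Φ (K [ p ↦ b ])
  eval-[/] (atom q) p b K with p ≟ q
  ... | yes _ = eval-const b K
  ... | no  _ = refl
  eval-[/] ⊤       p b K = refl
  eval-[/] ⊥       p b K = refl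
  eval-[/] (¬ Φ)   p b K = cong not (eval-[/] Φ p b K)
  eval-[/] (Φ ∧ Ψ) p b K = cong₂ Bool._∧_ (eval-[/] Φ p b K) (eval-[/] Ψ p b K)
  eval-[/] (Φ ∨ Ψ) p b K = cong₂ Bool._∨_ (eval-[/] Φ p b K) (eval-[/] Ψ p b K)
  eval-[/] (Φ ⊃ Ψ) p b K =
    cong₂ Bool._∨_ (cong not (eval-[/] Φ p b K)) (eval-[/] Ψ p b K)
  eval-[/] (∀[ q ] Φ) p b K with p ≟ q
  ... | yes refl = cong₂ Bool._∧_ (step true) (step false)
    where
    step : ∀ a → eval Φ (K [ p ↦ a ]) ≡ eval Φ (K [ p ↦ b ] [ p ↦ a ])
    step a = sym (eval-cong Φ (↦-shadow K p b a))
  ... | no p≢q = cong₂ Bool._∧_ (step true) (step false)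
    where
    step : ∀ a → eval (Φ [ p / b ]) (K [ q ↦ a ]) ≡ eval Φ (K [ p ↦ b ] [ q ↦ a ])
    step a = trans (eval-[/] Φ p b _) (eval-cong Φ (↦-swap K a b p≢q))
  eval-[/] (∃[ q ] Φ) p b K with p ≟ q
  ... | yes refl = cong₂ Bool._∨_ (step true) (step false)
    where
    step : ∀ a → eval Φ (K [ p ↦ a ]) ≡ eval Φ (K [ p ↦ b ] [ p ↦ a ])
    step a = sym (eval-cong Φ (↦-shadow K p b a))
  ... | no p≢q = cong₂ Bool._∨_ (step true) (step false)
    where
    step : ∀ a → eval (Φ [ p / b ]) (K [ q ↦ a ]) ≡ eval Φ (K [ p ↦ b ] [ q ↦ a ])
    step a = trans (eval-[/] Φ p b _) (eval-cong Φ (↦-swap K a b p≢q))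

  truth-acc-eval : ∀ K Φ (a : Acc ℕ._<_ (size Φ)) → truth-acc K Φ a ≡ eval Φ K
  truth-acc-eval K (atom p) _ = refl
  truth-acc-eval K ⊤        _ = refl
  truth-acc-eval K ⊥        _ = refl
  truth-acc-eval K (¬ Φ)    (acc rs) = cong not (truth-acc-eval K Φ _)
  truth-acc-eval K (Φ ∧ Ψ)  (acc rs) =
    cong₂ Bool._∧_ (truth-acc-eval K Φ _) (truth-acc-eval K Ψ _)
  truth-acc-eval K (Φ ∨ Ψ)  (acc rs) =
    cong₂ Bool._∨_ (truth-acc-eval K Φ _) (truth-acc-eval K Ψ _)
  truth-acc-eval K (Φ ⊃ Ψ)  (acc rs) =
    cong₂ Bool._∨_ (cong not (truth-acc-eval K Φ _)) (truth-acc-eval K Ψ _)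
  truth-acc-eval K (∀[ p ] Φ) (acc rs) = cong₂ Bool._∧_
    (trans (truth-acc-eval K (Φ [ p / true ]) (rs _)) (eval-[/] Φ p true K))
    (trans (truth-acc-eval K (Φ [ p / false ]) (rs _)) (eval-[/] Φ p false K))
  truth-acc-eval K (∃[ p ] Φ) (acc rs) = cong₂ Bool._∨_
    (trans (truth-acc-eval K (Φ [ p / true ]) (rs _)) (eval-[/] Φ p true K))
    (trans (truth-acc-eval K (Φ [ p / false ]) (rs _)) (eval-[/] Φ p false K))

  truth-eval : ∀ K Φ → truth K Φ ≡ eval Φ K
  truth-eval K Φ = truth-acc-eval K Φ (<-wellFounded (size Φ))

  ⊨-eval : ∀ Φ → (⊨⟨ _≟_ ⟩ Φ) ⇔ (∀ K → eval Φ K ≡ true)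
  ⊨-eval Φ = mk⇔ (λ v K → trans (sym (truth-eval K Φ)) (v K))
                 (λ v K → trans (truth-eval K Φ) (v K))

  eval-⌈⌉ : ∀ φ K → eval ⌈ φ ⌉ K ≡ ⟦ φ ⟧ K
  eval-⌈⌉ (atom p) K = refl
  eval-⌈⌉ ⊤        K = refl
  eval-⌈⌉ ⊥        K = refl
  eval-⌈⌉ (¬ φ)    K = cong not (eval-⌈⌉ φ K)
  eval-⌈⌉ (φ ∧ ψ)  K = cong₂ Bool._∧_ (eval-⌈⌉ φ K) (eval-⌈⌉ ψ K)
  eval-⌈⌉ (φ ∨ ψ)  K = cong₂ Bool._∨_ (eval-⌈⌉ φ K) (eval-⌈⌉ ψ K)
  eval-⌈⌉ (φ ⊃ ψ)  K = cong₂ Bool._∨_ (cong not (eval-⌈⌉ φ K)) (eval-⌈⌉ ψ K)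

  -- L differs from K at most on the atoms of P.
  Variant : List A → Interpretation A → Interpretation A → Set
  Variant P K L = ∀ p → p ∉ P → L p ≡ K p

  variant-↦ : ∀ {P K L} p b → Variant P (K [ p ↦ b ]) L → Variant (p ∷ P) K L
  variant-↦ p b v q q∉ with p ≟ q | v q (q∉ ∘ there)
  ... | yes refl | _ = contradiction (here refl) q∉
  ... | no  _    | e = e

  variant-∷ : ∀ {P K L p b} → L p ≡ b → Variant (p ∷ P) K L →
              Variant P (K [ p ↦ b ]) L
  variant-∷ {p = p} e v q q∉ with p ≟ q
  ... | yes refl = e
  ... | no p≢q   = v q λ { (here q≡p) → p≢q (sym q≡p) ; (there q∈) → q∉ q∈ }

  eval-∃* : ∀ P Φ {K} → (eval (∃*[ P ] Φ) K ≡ true) ⇔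
            (∃ λ L → Variant P K L × eval Φ L ≡ true)
  eval-∃* [] Φ {K} = mk⇔ (λ e → K , (λ _ _ → refl) , e)
    (λ (L , v , e) → trans (eval-cong Φ (λ p → sym (v p λ ()))) e)
  eval-∃* (p ∷ P) Φ {K} = mk⇔ split join
    where
    split : eval (∃*[ p ∷ P ] Φ) K ≡ true →
            ∃ λ L → Variant (p ∷ P) K L × eval Φ L ≡ true
    split e with to (∨-true (eval (∃*[ P ] Φ) (K [ p ↦ true ]))) e
    ... | inj₁ e₁ = let (L , v , eL) = to (eval-∃* P Φ) e₁ in L , variant-↦ p true v , eL
    ... | inj₂ e₂ = let (L , v , eL) = to (eval-∃* P Φ) e₂ in L , variant-↦ p false v , eL

    -- The value of p under the witness L selects the disjunct.
    join : (∃ λ L → Variant (p ∷ P) K L × eval Φ L ≡ true) →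
           eval (∃*[ p ∷ P ] Φ) K ≡ true
    join (L , v , e) with L p in Lp
    ... | true  = from (∨-true (eval (∃*[ P ] Φ) (K [ p ↦ true ])))
                    (inj₁ (from (eval-∃* P Φ) (L , variant-∷ Lp v , e)))
    ... | false = from (∨-true (eval (∃*[ P ] Φ) (K [ p ↦ true ])))
                    (inj₂ (from (eval-∃* P Φ) (L , variant-∷ Lp v , e)))

  eval-∀* : ∀ P Φ {K} → (eval (∀*[ P ] Φ) K ≡ true) ⇔
            (∀ L → Variant P K L → eval Φ L ≡ true)
  eval-∀* [] Φ {K} = mk⇔
    (λ e L v → trans (eval-cong Φ (λ p → v p λ ())) e)
    (λ f → f K (λ _ _ → refl))
  eval-∀* (p ∷ P) Φ {K} = mk⇔ inst gen
    where
    inst : eval (∀*[ p ∷ P ] Φ) K ≡ true →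
           ∀ L → Variant (p ∷ P) K L → eval Φ L ≡ true
    inst e L v with to (∧-true (eval (∀*[ P ] Φ) (K [ p ↦ true ]))) e | L p in Lp
    ... | e₁ , _ | true  = to (eval-∀* P Φ) e₁ L (variant-∷ Lp v)
    ... | _ , e₂ | false = to (eval-∀* P Φ) e₂ L (variant-∷ Lp v)

    gen : (∀ L → Variant (p ∷ P) K L → eval Φ L ≡ true) →
          eval (∀*[ p ∷ P ] Φ) K ≡ true
    gen f = from (∧-true (eval (∀*[ P ] Φ) (K [ p ↦ true ])))
      ( from (eval-∀* P Φ) (λ L v → f L (variant-↦ p true v))
      , from (eval-∀* P Φ) (λ L v → f L (variant-↦ p false v)) )

  -- The interpretation that is L on the atoms of P and K elsewhere.
  override : List A → Interpretation A → Interpretation A → Interpretation A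
  override P L K q = if Nullary.does (q ∈? P) then L q else K q

  override-∈ : ∀ P L K → override P L K ≗⟨ P ⟩ L
  override-∈ P L K {p} p∈ with p ∈? P
  ... | yes _  = refl
  ... | no  p∉ = contradiction p∈ p∉

  override-variant : ∀ P L K → Variant P K (override P L K)
  override-variant P L K p p∉ with p ∈? P
  ... | yes p∈ = contradiction p∈ p∉
  ... | no  _  = refl

-- Truth of formulas, reducts and translations

⟦⋀⟧-cong : ∀ {B C : Set} (xs : List X) {f : X → Formula B} {g : X → Formula C} {K L} →
           (∀ {x} → x ∈ xs → ⟦ f x ⟧ K ≡ ⟦ g x ⟧ L) →
           ⟦ ⋀ (map f xs) ⟧ K ≡ ⟦ ⋀ (map g xs) ⟧ L
⟦⋀⟧-cong []       e = refl
⟦⋀⟧-cong (x ∷ xs) e = cong₂ Bool._∧_ (e (here refl)) (⟦⋀⟧-cong xs (e ∘ there))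

-- The order S ≤ T on two sets of formulas indexed by the same list.
module _ {f g : X → Formula A} {K : Interpretation A} where

  ≤-true : ∀ xs → (K ⊩ (Vec.map f (fromList xs) ≤ Vec.map g (fromList xs))) ⇔
                  (∀ {x} → x ∈ xs → K ⊩ f x → K ⊩ g x)
  ≤-true []       = mk⇔ (λ _ ()) (λ _ → refl)
  ≤-true (x ∷ xs) = mk⇔
    (λ { e (here refl) → to (⊃-true (⟦ f x ⟧ K))
                            (proj₁ (to (∧-true (⟦ f x ⊃ g x ⟧ K)) e))
       ; e (there x∈)  → to (≤-true xs)
                            (proj₂ (to (∧-true (⟦ f x ⊃ g x ⟧ K)) e)) x∈ })
    (λ h → from (∧-true (⟦ f x ⊃ g x ⟧ K))
      ( from (⊃-true (⟦ f x ⟧ K)) (h (here refl))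
      , from (≤-true xs) (λ x∈ → h (there x∈))))

′-cong : ∀ (K : Interpretation (A ⁺)) I (φ : Formula A) →
         (K ∘ primed) ≗⟨ var φ ⟩ I → ⟦ φ ′ ⟧ K ≡ ⟦ φ ⟧ I
′-cong K I (atom p) e = e (here refl)
′-cong K I ⊤        e = refl
′-cong K I ⊥        e = refl
′-cong K I (¬ φ)    e = cong not (′-cong K I φ e)
′-cong K I (φ ∧ ψ)  e =
  cong₂ Bool._∧_ (′-cong K I φ (e ∘ ∈-++⁺ˡ)) (′-cong K I ψ (e ∘ ∈-++⁺ʳ (var φ)))
′-cong K I (φ ∨ ψ)  e =
  cong₂ Bool._∨_ (′-cong K I φ (e ∘ ∈-++⁺ˡ)) (′-cong K I ψ (e ∘ ∈-++⁺ʳ (var φ)))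
′-cong K I (φ ⊃ ψ)  e =
  cong₂ Bool._∨_ (cong not (′-cong K I φ (e ∘ ∈-++⁺ˡ))) (′-cong K I ψ (e ∘ ∈-++⁺ʳ (var φ)))

⟦if-⊤-⊥⟧ : ∀ b {I : Interpretation A} → ⟦ ⌊ if b then ⊤ else ⊥ ⌋ ⟧ I ≡ b
⟦if-⊤-⊥⟧ true  = refl
⟦if-⊤-⊥⟧ false = refl

reduct-self : (I : Interpretation A) (ψ : Expression A) →
              ⟦ ⌊ reduct I ψ ⌋ ⟧ I ≡ ⟦ ⌊ ψ ⌋ ⟧ I
reduct-self I (atom p) = refl
reduct-self I ⊤        = refl
reduct-self I ⊥        = refl
reduct-self I (¬ ψ)    = ⟦if-⊤-⊥⟧ (⟦ ⌊ ¬ ψ ⌋ ⟧ I)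
reduct-self I (ψ ∧ χ)  = cong₂ Bool._∧_ (reduct-self I ψ) (reduct-self I χ)
reduct-self I (ψ ∨ χ)  = cong₂ Bool._∨_ (reduct-self I ψ) (reduct-self I χ)

-- The primed atoms supply the interpretation that forms the reduct, the plain
-- ones the interpretation under which the reduct is evaluated.
τ-reduct : ∀ (L : Interpretation (A ⁺)) I J (ψ : Expression A) →
           (L ∘ primed) ≗⟨ var ⌊ ψ ⌋ ⟩ I → (L ∘ plain) ≗⟨ var ⌊ ψ ⌋ ⟩ J →
           ⟦ τ ψ ⟧ L ≡ ⟦ ⌊ reduct I ψ ⌋ ⟧ J
τ-reduct L I J (atom p) i j = j (here refl)
τ-reduct L I J ⊤        i j = refl
τ-reduct L I J ⊥        i j = refl
τ-reduct L I J (¬ ψ) i j =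
  trans (cong not (′-cong L I ⌊ ψ ⌋ i)) (sym (⟦if-⊤-⊥⟧ (⟦ ⌊ ¬ ψ ⌋ ⟧ I)))
τ-reduct L I J (ψ ∧ χ)  i j = cong₂ Bool._∧_
  (τ-reduct L I J ψ (i ∘ ∈-++⁺ˡ) (j ∘ ∈-++⁺ˡ))
  (τ-reduct L I J χ (i ∘ ∈-++⁺ʳ (var ⌊ ψ ⌋)) (j ∘ ∈-++⁺ʳ (var ⌊ ψ ⌋)))
τ-reduct L I J (ψ ∨ χ)  i j = cong₂ Bool._∨_
  (τ-reduct L I J ψ (i ∘ ∈-++⁺ˡ) (j ∘ ∈-++⁺ˡ))
  (τ-reduct L I J χ (i ∘ ∈-++⁺ʳ (var ⌊ ψ ⌋)) (j ∘ ∈-++⁺ʳ (var ⌊ ψ ⌋)))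

-- Models of the reduct

var-rule : ∀ {Π : Program A} {r} → r ∈ Π → var (⌊ B r ⌋ ⊃ ⌊ H r ⌋) ⊆ varᴾ Π
var-rule r∈ p∈ = ∈-concat⁺′ p∈ (∈-map⁺ var (∈-map⁺ (λ r → ⌊ B r ⌋ ⊃ ⌊ H r ⌋) r∈))

module _ (Π : Program A) where

  private V = varᴾ Π

  hat-reduct : ∀ I → hat (Π ^ I) ≡
               map (λ r → ⌊ reduct I (B r) ⌋ ⊃ ⌊ reduct I (H r) ⌋) Π
  hat-reduct I = sym (map-∘ Π)

  hat′-model : ∀ (K : Interpretation (A ⁺)) I → (K ∘ primed) ≗⟨ V ⟩ I →
               ⟦ ⋀ (map _′ (hat Π)) ⟧ K ≡ ⟦ ⋀ (hat (Π ^ I)) ⟧ I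
  hat′-model K I e =
    trans (cong (λ Γ → ⟦ ⋀ Γ ⟧ K) (sym (map-∘ Π)))
      (trans (⟦⋀⟧-cong Π rule) (cong (λ Γ → ⟦ ⋀ Γ ⟧ I) (sym (hat-reduct I))))
    where
    rule : ∀ {r} → r ∈ Π → ⟦ (⌊ B r ⌋ ⊃ ⌊ H r ⌋) ′ ⟧ K ≡
                           ⟦ ⌊ reduct I (B r) ⌋ ⊃ ⌊ reduct I (H r) ⌋ ⟧ I
    rule {r} r∈ = trans
      (′-cong K I (⌊ B r ⌋ ⊃ ⌊ H r ⌋) (e ∘ var-rule r∈))
      (sym (cong₂ Bool._∨_ (cong not (reduct-self I (B r))) (reduct-self I (H r))))

  τ-model : ∀ (L : Interpretation (A ⁺)) I J →
            (L ∘ primed) ≗⟨ V ⟩ I → (L ∘ plain) ≗⟨ V ⟩ J →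
            ⟦ ⋀ (map (λ r → τ (B r) ⊃ τ (H r)) Π) ⟧ L ≡ ⟦ ⋀ (hat (Π ^ I)) ⟧ J
  τ-model L I J i j =
    trans (⟦⋀⟧-cong Π rule) (cong (λ Γ → ⟦ ⋀ Γ ⟧ J) (sym (hat-reduct I)))
    where
    rule : ∀ {r} → r ∈ Π → ⟦ τ (B r) ⊃ τ (H r) ⟧ L ≡
                           ⟦ ⌊ reduct I (B r) ⌋ ⊃ ⌊ reduct I (H r) ⌋ ⟧ J
    rule {r} r∈ = cong₂ Bool._∨_
      (cong not (τ-reduct L I J (B r)
        (i ∘ var-rule r∈ ∘ ∈-++⁺ˡ) (j ∘ var-rule r∈ ∘ ∈-++⁺ˡ)))
      (τ-reduct L I J (H r)
        (i ∘ var-rule r∈ ∘ ∈-++⁺ʳ (var ⌊ B r ⌋))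
        (j ∘ var-rule r∈ ∘ ∈-++⁺ʳ (var ⌊ B r ⌋)))

  -- Under J and under J′, the reduct has the truth value of the translated
  -- rules when J′ interprets the plain atoms and I the primed ones.
  model-cong : ∀ I J J′ → J ≗⟨ V ⟩ J′ → Model (Π ^ I) J → Model (Π ^ I) J′
  model-cong I J J′ e m =
    trans (trans (sym (τ-model [ J′ , I ] I J′ (λ _ → refl) (λ _ → refl)))
                 (τ-model [ J′ , I ] I J (λ _ → refl) (sym ∘ e)))
          m

-- The encoding

primed∉plain : ∀ (P : List A) {p : A} → primed p ∉ map plain P
primed∉plain P p∈ with ∈-map⁻ plain p∈
... | _ , _ , ()

module Encoding {A : Set} (_≟_ : DecidableEquality A) (Π : Program A) where
  open Quantifiers _≟_ using (override; override-∈; override-variant)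
  module Q = Quantifiers (_≟_ ⁺-≟)
  open Q using (eval; eval-⌈⌉; eval-∃*)
  open DecMembership _≟_ using (_∈?_)

  private V = varᴾ Π

  -- No atom outside V belongs to I.
  Supported : Interpretation A → Set
  Supported I = ∀ {p} → I p ≡ true → p ∈ V

  ∅ : Interpretation A
  ∅ _ = false

  -- The atoms of V that belong to I.
  restrict : Interpretation A → Interpretation A
  restrict I = override V I ∅

  restrict-agree : ∀ I → I ≗⟨ V ⟩ restrict I
  restrict-agree I p∈ = sym (override-∈ V I ∅ p∈)

  restrict-supported : ∀ I → Supported (restrict I)
  restrict-supported I {p} e with p ∈? V
  ... | yes p∈ = p∈
  restrict-supported I () | no _

  restrict-⊑ : ∀ I → restrict I ⊑ I
  restrict-⊑ I p e = trans (restrict-agree I (restrict-supported I e)) e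

  stable-support : ∀ {I} → StableModel Π I → Supported I
  stable-support {I} (m , minimal) {p} Ip =
    restrict-supported I (minimal (restrict I)
      (model-cong Π I I (restrict I) (restrict-agree I) m) (restrict-⊑ I) p Ip)

  private
    -- The constituents of 𝒮[ Π ]; `smaller` is the scope of its quantifiers.
    V≤V′ V′≤V V<V′ τ-rules Π′ : Formula (A ⁺)
    V≤V′ = Vec.map (λ p → atom (plain p)) (fromList V) ≤
           Vec.map (λ p → atom (primed p)) (fromList V)
    V′≤V = Vec.map (λ p → atom (primed p)) (fromList V) ≤
           Vec.map (λ p → atom (plain p)) (fromList V)
    V<V′ = V≤V′ ∧ ¬ V′≤V
    τ-rules = ⋀ (map (λ r → τ (B r) ⊃ τ (H r)) Π)
    Π′ = ⋀ (map _′ (hat Π))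

    smaller : QBF (A ⁺)
    smaller = ⌈ V<V′ ⌉ ∧ ⌈ τ-rules ⌉

  -- A witness for the plain atoms is a competitor of I.  Without the support
  -- condition, I could exceed a competitor outside V only, which V < V′ does
  -- not express.
  smaller-model : ∀ K I → (K ∘ primed) ≗⟨ V ⟩ I → Supported I →
    (eval (∃*[ map plain V ] smaller) K ≡ true) ⇔
    (∃ λ J → Model (Π ^ I) J × J ⊑ I × Nullary.¬ (I ⊑ J))
  smaller-model K I agree supp = mk⇔ extract embed
    where
    extract : eval (∃*[ map plain V ] smaller) K ≡ true →
              ∃ λ J → Model (Π ^ I) J × J ⊑ I × Nullary.¬ (I ⊑ J)
    extract e with to (eval-∃* (map plain V) smaller) e
    ... | L , v , eL = J , model , (λ p → proj₂ ∘ to (∧-true (L (plain p)))) , strict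
      where
      parts = to (∧-true (eval ⌈ V<V′ ⌉ L)) eL
      less  = to (∧-true (⟦ V≤V′ ⟧ L)) (trans (sym (eval-⌈⌉ V<V′ L)) (proj₁ parts))
      below = to (≤-true V) (proj₁ less)

      L-agree : (L ∘ primed) ≗⟨ V ⟩ I
      L-agree p∈ = trans (v _ (primed∉plain V)) (agree p∈)

      -- The plain atoms outside V are unconstrained; intersecting with I
      -- makes J a subset of I without changing it on V.
      J : Interpretation A
      J p = L (plain p) Bool.∧ I p

      J-agree : (L ∘ plain) ≗⟨ V ⟩ J
      J-agree {p} p∈ with L (plain p) in Lp
      ... | true  = sym (trans (sym (L-agree p∈)) (below p∈ Lp))
      ... | false = refl

      model : Model (Π ^ I) J
      model = trans (sym (τ-model Π L I J L-agree J-agree))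
                    (trans (sym (eval-⌈⌉ τ-rules L)) (proj₂ parts))

      strict : Nullary.¬ (I ⊑ J)
      strict I⊑J = to not-true (proj₂ less) (from (≤-true V)
        (λ {p} p∈ e → proj₁ (to (∧-true (L (plain p)))
          (I⊑J p (trans (sym (L-agree p∈)) e)))))

    embed : (∃ λ J → Model (Π ^ I) J × J ⊑ I × Nullary.¬ (I ⊑ J)) →
            eval (∃*[ map plain V ] smaller) K ≡ true
    embed (J , model , J⊑I , strict) =
      from (eval-∃* (map plain V) smaller)
        ( L , variant
        , from (∧-true (eval ⌈ V<V′ ⌉ L))
          ( trans (eval-⌈⌉ V<V′ L) (from (∧-true (⟦ V≤V′ ⟧ L))
              (from (≤-true V) below , from not-true above))
          , trans (eval-⌈⌉ τ-rules L) (trans (τ-model Π L I J L-agree J-agree) model)))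
      where
      L : Interpretation (A ⁺)
      L = Q.override (map plain V) [ J , K ∘ primed ] K

      variant : Q.Variant (map plain V) K L
      variant = Q.override-variant (map plain V) [ J , K ∘ primed ] K

      L-agree : (L ∘ primed) ≗⟨ V ⟩ I
      L-agree p∈ = trans (variant _ (primed∉plain V)) (agree p∈)

      J-agree : (L ∘ plain) ≗⟨ V ⟩ J
      J-agree p∈ = Q.override-∈ (map plain V) [ J , K ∘ primed ] K (∈-map⁺ plain p∈)

      below : ∀ {p} → p ∈ V → L (plain p) ≡ true → L (primed p) ≡ true
      below p∈ e = trans (L-agree p∈) (J⊑I _ (trans (sym (J-agree p∈)) e))

      above : Nullary.¬ (L ⊩ V′≤V)
      above e = strict λ p Ip → let p∈ = supp Ip in
        trans (sym (J-agree p∈)) (to (≤-true V) e p∈ (trans (L-agree p∈) Ip))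

  𝒮-stable : ∀ K I → (K ∘ primed) ≗⟨ V ⟩ I → Supported I →
             (eval 𝒮[ Π ] K ≡ true) ⇔ StableModel Π I
  𝒮-stable K I agree supp = mk⇔ stable encoded
    where
    hat≡ : eval ⌈ Π′ ⌉ K ≡ ⟦ ⋀ (hat (Π ^ I)) ⟧ I
    hat≡ = trans (eval-⌈⌉ Π′ K) (hat′-model Π K I agree)

    stable : eval 𝒮[ Π ] K ≡ true → StableModel Π I
    stable e = trans (sym hat≡) (proj₁ (to (∧-true (eval ⌈ Π′ ⌉ K)) e)) , minimal
      where
      minimal : ∀ J → Model (Π ^ I) J → J ⊑ I → I ⊑ J
      -- An atom of I missing from J would make J a strictly smaller model.
      minimal J m J⊑I p Ip with J p in Jp
      ... | true  = refl
      ... | false = contradiction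
        (from (smaller-model K I agree supp)
          (J , m , J⊑I , λ I⊑J → not-¬ Jp (I⊑J p Ip)))
        (to not-true (proj₂ (to (∧-true (eval ⌈ Π′ ⌉ K)) e)))

    encoded : StableModel Π I → eval 𝒮[ Π ] K ≡ true
    encoded (m , minimal) = from (∧-true (eval ⌈ Π′ ⌉ K))
      ( trans hat≡ m
      , from not-true λ e →
          let (J , mJ , J⊑I , I⋢J) = to (smaller-model K I agree supp) e
          in  I⋢J (minimal J mJ J⊑I) )

  𝒮-restrict : ∀ K → eval 𝒮[ Π ] K ≡ true → StableModel Π (restrict (K ∘ primed))
  𝒮-restrict K =
    to (𝒮-stable K (restrict (K ∘ primed))
                   (restrict-agree (K ∘ primed)) (restrict-supported (K ∘ primed)))

  -- If var(φ) lies in V, cutting an interpretation down to V preserves φ.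
  ′-restrict : ∀ φ K → var φ ⊆ V →
               eval ⌈ φ ′ ⌉ K ≡ ⟦ φ ⟧ (restrict (K ∘ primed))
  ′-restrict φ K φ⊆ =
    trans (eval-⌈⌉ (φ ′) K)
          (′-cong K (restrict (K ∘ primed)) φ (restrict-agree (K ∘ primed) ∘ φ⊆))

  -- K with its values at the primed atoms of P replaced by those of I.
  prime-override : List A → Interpretation A → Interpretation (A ⁺) → Interpretation (A ⁺)
  prime-override P I K = Q.override (map primed P) [ K ∘ plain , I ] K

  module _ (P : List A) (I : Interpretation A) (K : Interpretation (A ⁺)) where

    prime-variant : Q.Variant (map primed P) K (prime-override P I K)
    prime-variant = Q.override-variant (map primed P) [ K ∘ plain , I ] K

    prime-agree : (prime-override P I K ∘ primed) ≗⟨ P ⟩ I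
    prime-agree p∈ = Q.override-∈ (map primed P) [ K ∘ plain , I ] K (∈-map⁺ primed p∈)

    prime-𝒮 : V ⊆ P → StableModel Π I → eval 𝒮[ Π ] (prime-override P I K) ≡ true
    prime-𝒮 V⊆P st =
      from (𝒮-stable (prime-override P I K) I (prime-agree ∘ V⊆P) (stable-support st)) st

    prime-formula : ∀ φ → var φ ⊆ P → eval ⌈ φ ′ ⌉ (prime-override P I K) ≡ ⟦ φ ⟧ I
    prime-formula φ φ⊆P =
      trans (eval-⌈⌉ (φ ′) (prime-override P I K))
            (′-cong (prime-override P I K) I φ (prime-agree ∘ φ⊆P))

corollary2 :
  {A : Set} (_≟_ : DecidableEquality A) (Π : Program A) (φ : Formula A) →
  let V  = varᴾ Π
      W  = varᴾ Π ++ var φ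
      V′ = map primed V
      W′ = map primed W
  in
  (∃ (StableModel Π) ⇔ ⊨⟨ _≟_ ⁺-≟ ⟩ ∃*[ V′ ] 𝒮[ Π ])
  × ((Π ∣∼b φ → ⊨⟨ _≟_ ⁺-≟ ⟩ ∃*[ W′ ] (𝒮[ Π ] ∧ ⌈ φ ′ ⌉))
     × (var φ ⊆ V → ⊨⟨ _≟_ ⁺-≟ ⟩ ∃*[ W′ ] (𝒮[ Π ] ∧ ⌈ φ ′ ⌉) → Π ∣∼b φ))
  × ((⊨⟨ _≟_ ⁺-≟ ⟩ ∀*[ W′ ] (𝒮[ Π ] ⊃ ⌈ φ ′ ⌉) → Π ∣∼s φ)
     × (var φ ⊆ V → Π ∣∼s φ → ⊨⟨ _≟_ ⁺-≟ ⟩ ∀*[ W′ ] (𝒮[ Π ] ⊃ ⌈ φ ′ ⌉)))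
corollary2 {A} _≟_ Π φ =
    mk⇔ (λ (I , st) → from (⊨-eval Φ₁) λ K → from (eval-∃* V′ 𝒮[ Π ])
          (prime-override V I K , prime-variant V I K , prime-𝒮 V I K (λ p∈ → p∈) st))
        (λ v → let (L , _ , e) = to (eval-∃* V′ 𝒮[ Π ]) (to (⊨-eval Φ₁) v falsum)
               in  restrict (L ∘ primed) , 𝒮-restrict L e)
  , ( (λ (I , st , Iφ) → from (⊨-eval Φ₂) λ K → from (eval-∃* W′ (𝒮[ Π ] ∧ ⌈ φ ′ ⌉))
          ( prime-override W I K , prime-variant W I K
          , from (∧-true (eval 𝒮[ Π ] (prime-override W I K)))
              ( prime-𝒮 W I K ∈-++⁺ˡ st
              , trans (prime-formula W I K φ (∈-++⁺ʳ V)) Iφ )))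
    , (λ φ⊆V v →
          let (L , _ , e) = to (eval-∃* W′ (𝒮[ Π ] ∧ ⌈ φ ′ ⌉)) (to (⊨-eval Φ₂) v falsum)
              (e𝒮 , eφ)   = to (∧-true (eval 𝒮[ Π ] L)) e
          in  restrict (L ∘ primed) , 𝒮-restrict L e𝒮
              , trans (sym (′-restrict φ L φ⊆V)) eφ) )
  , ( (λ v I st →
          let K = prime-override W I falsum
              e = to (eval-∀* W′ (𝒮[ Π ] ⊃ ⌈ φ ′ ⌉)) (to (⊨-eval Φ₃) v falsum)
                    K (prime-variant W I falsum)
          in  trans (sym (prime-formula W I falsum φ (∈-++⁺ʳ V)))
                (to (⊃-true (eval 𝒮[ Π ] K)) e (prime-𝒮 W I falsum ∈-++⁺ˡ st)))
    , (λ φ⊆V s → from (⊨-eval Φ₃) λ K → from (eval-∀* W′ (𝒮[ Π ] ⊃ ⌈ φ ′ ⌉)) λ L _ →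
          from (⊃-true (eval 𝒮[ Π ] L)) λ e →
            trans (′-restrict φ L φ⊆V) (s (restrict (L ∘ primed)) (𝒮-restrict L e))) )
  where
  open Quantifiers (_≟_ ⁺-≟)
  open Encoding _≟_ Π

  V  = varᴾ Π
  W  = V ++ var φ
  V′ = map primed V
  W′ = map primed W

  Φ₁ Φ₂ Φ₃ : QBF (A ⁺)
  Φ₁ = ∃*[ V′ ] 𝒮[ Π ]
  Φ₂ = ∃*[ W′ ] (𝒮[ Π ] ∧ ⌈ φ ′ ⌉)
  Φ₃ = ∀*[ W′ ] (𝒮[ Π ] ⊃ ⌈ φ ′ ⌉)

  -- Validity is used at a single interpretation.  Any one serves: the
  -- quantifiers range over all values of the primed atoms that matter.
  falsum : Interpretation (A ⁺)
  falsum _ = false
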